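{- For every integer $n\ge 6$, $I(P_n^{\ast},x)=I(G_{2n},x)$.
   Context: All graphs are finite, simple and undirected. The independence polynomial of a graph $G$ is $I(G,x)=\sum_{k\ge 0} i_kx^k$, where $i_k$ is the number of independent sets of size $k$ in $G$. $P_n$ is the path of order $n$. For a graph $G$, the graph star $G^{\ast}$ is obtained from $G$ by attaching, for each vertex $v$ of $G$, a new vertex $v^{\ast}$ joined by an edge to $v$ only. The trees $G_{2n}$ ($n\ge 5$) are defined recursively. $G_{10}$ is the tree with vertex set $\{v_1,v_2,v_3,v_4,v_5,x_1,x_2,y_1,y_2,z_1\}$ and edges $v_1v_2,\ v_2v_3,\ v_3v_4,\ v_4v_5,\ v_5x_1,\ x_1x_2,\ v_3y_1,\ y_1y_2,\ v_3z_1$. For $n\ge 5$, $G_{2(n+1)}$ is obtained from $G_{2n}$ by adding a disjoint copy of $K_2$ with vertices labelled $v_{n+1}$ and $w_{n+1}$, and joining $v_n$ and $v_{n+1}$ by an edge. -}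

module Defs where

open import Data.Empty using (⊥)
open import Data.Fin using (Fin; zero; suc; toℕ; splitAt; #_)
open import Data.Fin.Properties using (all?) renaming (_≟_ to _≟ᶠ_)
open import Data.Fin.Subset using (Subset; inside; outside; _∈_; ∣_∣)
open import Data.Fin.Subset.Properties using (_∈?_; ∣p∣≤n)
open import Data.List using (List; []; _∷_; _++_; map; filter; length)
open import Data.List.Properties using (filter-none)
open import Data.List.Relation.Unary.All using (All; universal; lookup) renaming (all? to allList?)
import Data.List.Membership.Propositional as List
import Data.List.Membership.DecPropositional as DecMembership
open import Data.Nat using (ℕ; zero; suc; _+_; _*_; _≤_; _<_; z≤n; s≤s; _≟_)
open import Data.Nat.Properties using (<⇒≱; 1+n≢n)
open import Data.Product using (_×_; _,_; proj₁; uncurry)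
open import Data.Product.Properties using (≡-dec)
open import Data.Sum using (_⊎_; inj₁; inj₂; [_,_]′; swap)
open import Data.Unit using (⊤; tt)
open import Data.Vec using ([]; _∷_)
open import Relation.Binary.Core using (Rel)
open import Relation.Binary.Definitions using (Decidable; Symmetric)
open import Relation.Binary.PropositionalEquality using (_≡_; _≢_; refl; sym; cong; subst)
open import Relation.Nullary using (¬_; Dec; yes; no)
open import Relation.Nullary.Decidable using (_×-dec_; _→-dec_; _⊎-dec_; ¬?; from-yes)
open import Level using (0ℓ)

-- Finite simple undirected graphs with vertex set Fin n.

record Graph (n : ℕ) : Set₁ where
  field
    Adj       : Rel (Fin n) 0ℓ
    adj?      : Decidable Adj
    symmetric : Symmetric Adj
    loopless  : ∀ u → ¬ Adj u u

open Graph

-- Finitely supported sequences of natural coefficients.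

record Polynomial : Set where
  field
    coeff    : ℕ → ℕ
    bound    : ℕ
    vanishes : ∀ k → bound < k → coeff k ≡ 0

open Polynomial public using (coeff)

-- The bound is only a witness of finite support, so equality ignores it.
infix 4 _≈_
_≈_ : Polynomial → Polynomial → Set
p ≈ q = ∀ k → coeff p k ≡ coeff q k

Independent : ∀ {n} → Graph n → Subset n → Set
Independent G S = ∀ u → u ∈ S → ∀ v → v ∈ S → ¬ Adj G u v

independent? : ∀ {n} (G : Graph n) (S : Subset n) → Dec (Independent G S)
independent? G S =
  all? λ u → (u ∈? S) →-dec all? λ v → (v ∈? S) →-dec ¬? (adj? G u v)

-- Every subset of Fin n, listed exactly once.
subsets : ∀ n → List (Subset n)
subsets zero    = [] ∷ []
subsets (suc n) = map (outside ∷_) (subsets n) ++ map (inside ∷_) (subsets n)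

independentSets : ∀ {n} → Graph n → ℕ → List (Subset n)
independentSets {n} G k =
  filter (λ S → independent? G S ×-dec (∣ S ∣ ≟ k)) (subsets n)

I : ∀ {n} → Graph n → Polynomial
I {n} G = record
  { coeff    = λ k → length (independentSets G k)
  ; bound    = n
  ; vanishes = λ k n<k → cong length
      (filter-none (λ S → independent? G S ×-dec (∣ S ∣ ≟ k))
        (universal (λ S (_ , ∣S∣≡k) → <⇒≱ n<k (subst (_≤ n) ∣S∣≡k (∣p∣≤n S)))
                   (subsets n)))
  }

P : ∀ n → Graph n
P n = record
  { Adj       = λ u v → (suc (toℕ u) ≡ toℕ v) ⊎ (suc (toℕ v) ≡ toℕ u)
  ; adj?      = λ u v → (suc (toℕ u) ≟ toℕ v) ⊎-dec (suc (toℕ v) ≟ toℕ u)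
  ; symmetric = swap
  ; loopless  = λ _ → [ 1+n≢n , 1+n≢n ]′
  }

-- In the star of G, the vertex v is inj₁ v and the attached v* is inj₂ v,
-- under the identification of Fin (n + n) with Fin n ⊎ Fin n.

module _ {n} (G : Graph n) where

  StarAdj : Rel (Fin n ⊎ Fin n) 0ℓ
  StarAdj (inj₁ u) (inj₁ v) = Adj G u v
  StarAdj (inj₁ u) (inj₂ v) = u ≡ v
  StarAdj (inj₂ u) (inj₁ v) = u ≡ v
  StarAdj (inj₂ _) (inj₂ _) = ⊥

  starAdj? : Decidable StarAdj
  starAdj? (inj₁ u) (inj₁ v) = adj? G u v
  starAdj? (inj₁ u) (inj₂ v) = u ≟ᶠ v
  starAdj? (inj₂ u) (inj₁ v) = u ≟ᶠ v
  starAdj? (inj₂ _) (inj₂ _) = no λ ()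

  starAdj-sym : Symmetric StarAdj
  starAdj-sym {inj₁ _} {inj₁ _} = symmetric G
  starAdj-sym {inj₁ _} {inj₂ _} = sym
  starAdj-sym {inj₂ _} {inj₁ _} = sym

  starAdj-loopless : ∀ u → ¬ StarAdj u u
  starAdj-loopless (inj₁ u) = loopless G u
  starAdj-loopless (inj₂ _) = λ ()

infix 8 _*ᴳ
_*ᴳ : ∀ {n} → Graph n → Graph (n + n)
_*ᴳ {n} G = record
  { Adj       = λ u v → StarAdj G (splitAt n u) (splitAt n v)
  ; adj?      = λ u v → starAdj? G (splitAt n u) (splitAt n v)
  ; symmetric = λ {u} {v} → starAdj-sym G {splitAt n u} {splitAt n v}
  ; loopless  = λ u → starAdj-loopless G (splitAt n u)
  }

module _ {n} (E : List (Fin n × Fin n)) where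

  open DecMembership (≡-dec (_≟ᶠ_ {n}) (_≟ᶠ_ {n})) using () renaming (_∈?_ to _∈ᴸ?_)

  fromEdges : All (uncurry _≢_) E → Graph n
  fromEdges distinct = record
    { Adj       = λ u v → ((u , v) List.∈ E) ⊎ ((v , u) List.∈ E)
    ; adj?      = λ u v → ((u , v) ∈ᴸ? E) ⊎-dec ((v , u) ∈ᴸ? E)
    ; symmetric = swap
    ; loopless  = λ u → [ (λ e → lookup distinct e refl) , (λ e → lookup distinct e refl) ]′
    }

-- A disjoint K₂ with vertices zero and suc zero is added to G, and zero is
-- joined to r; the vertex u of G becomes suc (suc u).

module _ {n} (G : Graph n) (r : Fin n) where

  AppendAdj : Rel (Fin (2 + n)) 0ℓ
  AppendAdj zero          zero          = ⊥
  AppendAdj zero          (suc zero)    = ⊤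
  AppendAdj zero          (suc (suc v)) = v ≡ r
  AppendAdj (suc zero)    zero          = ⊤
  AppendAdj (suc zero)    (suc _)       = ⊥
  AppendAdj (suc (suc u)) zero          = u ≡ r
  AppendAdj (suc (suc _)) (suc zero)    = ⊥
  AppendAdj (suc (suc u)) (suc (suc v)) = Adj G u v

  appendAdj? : Decidable AppendAdj
  appendAdj? zero          zero          = no λ ()
  appendAdj? zero          (suc zero)    = yes tt
  appendAdj? zero          (suc (suc v)) = v ≟ᶠ r
  appendAdj? (suc zero)    zero          = yes tt
  appendAdj? (suc zero)    (suc _)       = no λ ()
  appendAdj? (suc (suc u)) zero          = u ≟ᶠ r
  appendAdj? (suc (suc _)) (suc zero)    = no λ ()
  appendAdj? (suc (suc u)) (suc (suc v)) = adj? G u v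

  appendAdj-sym : Symmetric AppendAdj
  appendAdj-sym {zero}        {suc zero}    = λ e → e
  appendAdj-sym {zero}        {suc (suc _)} = λ e → e
  appendAdj-sym {suc zero}    {zero}        = λ e → e
  appendAdj-sym {suc (suc _)} {zero}        = λ e → e
  appendAdj-sym {suc (suc _)} {suc (suc _)} = symmetric G

  appendAdj-loopless : ∀ u → ¬ AppendAdj u u
  appendAdj-loopless zero          = λ ()
  appendAdj-loopless (suc zero)    = λ ()
  appendAdj-loopless (suc (suc u)) = loopless G u

  appendK₂ : Graph (2 + n)
  appendK₂ = record
    { Adj       = AppendAdj
    ; adj?      = appendAdj?
    ; symmetric = λ {u} {v} → appendAdj-sym {u} {v}
    ; loopless  = appendAdj-loopless
    }

v₁ v₂ v₃ v₄ v₅ x₁ x₂ y₁ y₂ z₁ : Fin 10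
v₁ = # 0
v₂ = # 1
v₃ = # 2
v₄ = # 3
v₅ = # 4
x₁ = # 5
x₂ = # 6
y₁ = # 7
y₂ = # 8
z₁ = # 9

edges₁₀ : List (Fin 10 × Fin 10)
edges₁₀ = (v₁ , v₂) ∷ (v₂ , v₃) ∷ (v₃ , v₄) ∷ (v₄ , v₅) ∷ (v₅ , x₁)
        ∷ (x₁ , x₂) ∷ (v₃ , y₁) ∷ (y₁ , y₂) ∷ (v₃ , z₁) ∷ []

G₁₀ : Graph 10
G₁₀ = fromEdges edges₁₀ (from-yes (allList? (λ (u , v) → ¬? (u ≟ᶠ v)) edges₁₀))

-- tree m is G_{2n} for n = 5 + m, together with its vertex vₙ.
tree : ∀ m → Graph ((5 + m) * 2) × Fin ((5 + m) * 2)
tree zero    = G₁₀ , v₅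
tree (suc m) = let G , vₙ = tree m in appendK₂ G vₙ , zero

-- G₂ n 5≤n is G_{2n}; matching on 5 ≤ n gives n = 5 + m.
G₂ : ∀ n → 5 ≤ n → Graph (n * 2)
G₂ _ (s≤s (s≤s (s≤s (s≤s (s≤s (z≤n {m})))))) = proj₁ (tree m)

{-# OPTIONS --safe #-}
-- Writing F n for I (P n *ᴳ) and conditioning on the end vertex of the path,
-- F (n + 2) = (1 + x) F (n + 1) + x (1 + x) F n.  Conditioning on vₙ, and with
-- A n counting only the independent sets of G_{2n} that avoid vₙ,
-- I G_{2n+2} = (1 + x) I G_{2n} + x A n and A (n + 1) = (1 + x) I G_{2n}.
-- So I G_{2n} = F n and A n = (1 + x) F (n - 1) propagate from n = 5, where
-- both are checked by computation.
module Submission where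

open import Defs
open import Data.Bool using (true; false; if_then_else_)
open import Data.Fin using (Fin; zero; suc; splitAt; _↑ˡ_; _↑ʳ_)
open import Data.Fin.Properties using (all?; splitAt-↑ˡ; splitAt-↑ʳ; splitAt⁻¹-↑ˡ; splitAt⁻¹-↑ʳ)
open import Data.Fin.Subset using (Subset; inside; outside; _∈_; _∉_; ∣_∣)
open import Data.Fin.Subset.Properties using (_∈?_)
open import Data.List using (List; []; _∷_; map; filter; length)
import Data.List.Membership.Propositional as List
open import Data.List.Properties using (filter-++; filter-none; filter-≐; length-++)
open import Data.List.Relation.Unary.All as All using (All; universal)
open import Data.Nat using (ℕ; zero; suc; _+_; _≤_; z≤n; s≤s; _≟_)
open import Data.Nat.Properties using (<⇒≤; suc-injective; +-identityʳ; +-commutativeSemigroup)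
open import Algebra.Properties.CommutativeSemigroup +-commutativeSemigroup using (interchange)
open import Data.Product using (_×_; _,_; proj₁)
open import Data.Product.Function.NonDependent.Propositional using (_×-⇔_)
open import Data.Sum as Sum using (_⊎_; inj₁; inj₂; [_,_]′)
open import Data.Vec using ([]; _∷_; _++_; here; there)
open import Data.Vec.Properties using (lookup-++ˡ; lookup-++ʳ; []=⇒lookup; lookup⇒[]=)
open import Function using (_∘_; id; _⇔_; mk⇔; Equivalence)
open import Function.Properties.Equivalence using () renaming (trans to ⇔-trans)
open import Level using (0ℓ)
open import Relation.Binary.PropositionalEquality using (_≡_; _≗_; refl; sym; trans; cong; cong₂; subst₂)
open import Relation.Nullary using (¬_; Dec; does)
open import Relation.Nullary.Decidable using (_×-dec_; _→-dec_; ¬?; does-⇔; dec-false)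
open import Relation.Unary using (Pred; Decidable)

open Graph
open Equivalence using (to; from)

-- Polynomials as coefficient sequences

Coeffs : Set
Coeffs = ℕ → ℕ

0# 1# : Coeffs
0# _ = 0
1# zero    = 1
1# (suc _) = 0

infixl 6 _⊕_
_⊕_ : Coeffs → Coeffs → Coeffs
(f ⊕ g) k = f k + g k

X· : Coeffs → Coeffs
X· f zero    = 0
X· f (suc k) = f k

[1+X]· : Coeffs → Coeffs
[1+X]· f = f ⊕ X· f

≗-refl : {f : Coeffs} → f ≗ f
≗-refl _ = refl

≗-sym : {f g : Coeffs} → f ≗ g → g ≗ f
≗-sym e k = sym (e k)

infixr 4 _▸_
_▸_ : {f g h : Coeffs} → f ≗ g → g ≗ h → f ≗ h
(d ▸ e) k = trans (d k) (e k)

⊕-cong : {f f′ g g′ : Coeffs} → f ≗ f′ → g ≗ g′ → f ⊕ g ≗ f′ ⊕ g′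
⊕-cong d e k = cong₂ _+_ (d k) (e k)

⊕-identityʳ : (f : Coeffs) {g : Coeffs} → g ≗ 0# → f ⊕ g ≗ f
⊕-identityʳ f e k = trans (cong (f k +_) (e k)) (+-identityʳ (f k))

X·-cong : {f g : Coeffs} → f ≗ g → X· f ≗ X· g
X·-cong e zero    = refl
X·-cong e (suc k) = e k

X·-⊕ : (f g : Coeffs) → X· (f ⊕ g) ≗ X· f ⊕ X· g
X·-⊕ f g zero    = refl
X·-⊕ f g (suc k) = refl

X·-0# : X· 0# ≗ 0#
X·-0# zero    = refl
X·-0# (suc k) = refl

[1+X]·-cong : {f g : Coeffs} → f ≗ g → [1+X]· f ≗ [1+X]· g
[1+X]·-cong e = ⊕-cong e (X·-cong e)

-- Only the boolean `does a?` is inspected, so deciders of equivalent propositions yield the same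
-- sequence and summands can be rewritten along `⇔`.
when : ∀ {A : Set} → Dec A → Coeffs → Coeffs
when a? f = if does a? then f else 0#

when-cong : ∀ {A B : Set} (a? : Dec A) (b? : Dec B) {f g : Coeffs} →
            A ⇔ B → f ≗ g → when a? f ≗ when b? g
when-cong a? b? A⇔B e rewrite does-⇔ A⇔B a? b? with does b?
... | true  = e
... | false = ≗-refl

when-false : ∀ {A : Set} (a? : Dec A) {f : Coeffs} → ¬ A → when a? f ≗ 0#
when-false a? ¬a rewrite dec-false a? ¬a = ≗-refl

when-×-dec : ∀ {A B : Set} (a? : Dec A) (b? : Dec B) {f : Coeffs} →
             when (a? ×-dec b?) f ≗ when a? (when b? f)
when-×-dec a? b? with does a?
... | true  = ≗-refl
... | false = ≗-refl

when-[1+X]· : ∀ {A : Set} (a? : Dec A) {f : Coeffs} →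
              when a? ([1+X]· f) ≗ [1+X]· (when a? f)
when-[1+X]· a? with does a?
... | true  = ≗-refl
... | false = ≗-sym (⊕-identityʳ 0# X·-0#)

-- Weighted sums over subsets

-- Opaque, because otherwise conversion checking expands sums over Subset 10
-- and unification does not see Σ as injective.
opaque

  -- Σ f is the sum of x ^ ∣ S ∣ · f S over all subsets S.
  Σ : ∀ {n} → (Subset n → Coeffs) → Coeffs
  Σ {zero}  f = f []
  Σ {suc n} f = Σ (λ S → f (outside ∷ S)) ⊕ X· (Σ (λ S → f (inside ∷ S)))

  Σ-[] : (f : Subset 0 → Coeffs) → Σ f ≗ f []
  Σ-[] f = ≗-refl

  Σ-∷ : ∀ {n} (f : Subset (suc n) → Coeffs) →
        Σ f ≗ Σ (λ S → f (outside ∷ S)) ⊕ X· (Σ (λ S → f (inside ∷ S)))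
  Σ-∷ f = ≗-refl

Σ-∷-cong : ∀ {n} (f : Subset (suc n) → Coeffs) {g h : Coeffs} →
           Σ (λ S → f (outside ∷ S)) ≗ g → Σ (λ S → f (inside ∷ S)) ≗ h → Σ f ≗ g ⊕ X· h
Σ-∷-cong f d e = Σ-∷ f ▸ ⊕-cong d (X·-cong e)

Σ-cong : ∀ {n} {f g : Subset n → Coeffs} → (∀ S → f S ≗ g S) → Σ f ≗ Σ g
Σ-cong {zero}  {f} {g} e = Σ-[] f ▸ e [] ▸ ≗-sym (Σ-[] g)
Σ-cong {suc n} {f} {g} e =
  Σ-∷-cong f (Σ-cong (λ S → e (outside ∷ S))) (Σ-cong (λ S → e (inside ∷ S))) ▸ ≗-sym (Σ-∷ g)

Σ-0# : ∀ {n} {f : Subset n → Coeffs} → (∀ S → f S ≗ 0#) → Σ f ≗ 0#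
Σ-0# {zero}  {f} e = Σ-[] f ▸ e []
Σ-0# {suc n} {f} e =
  Σ-∷-cong f (Σ-0# (λ S → e (outside ∷ S))) (Σ-0# (λ S → e (inside ∷ S))) ▸ X·-0#

Σ-⊕ : ∀ {n} (f g : Subset n → Coeffs) → Σ (λ S → f S ⊕ g S) ≗ Σ f ⊕ Σ g
Σ-⊕ {zero}  f g = Σ-[] (λ S → f S ⊕ g S) ▸ ≗-sym (⊕-cong (Σ-[] f) (Σ-[] g))
Σ-⊕ {suc n} f g =
  Σ-∷-cong (λ S → f S ⊕ g S) (Σ-⊕ f₀ g₀) (Σ-⊕ f₁ g₁)
  ▸ ⊕-cong ≗-refl (X·-⊕ (Σ f₁) (Σ g₁))
  ▸ (λ k → interchange (Σ f₀ k) (Σ g₀ k) (X· (Σ f₁) k) (X· (Σ g₁) k))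
  ▸ ≗-sym (⊕-cong (Σ-∷ f) (Σ-∷ g))
  where
  f₀ = λ S → f (outside ∷ S)
  f₁ = λ S → f (inside ∷ S)
  g₀ = λ S → g (outside ∷ S)
  g₁ = λ S → g (inside ∷ S)

Σ-X· : ∀ {n} (f : Subset n → Coeffs) → Σ (λ S → X· (f S)) ≗ X· (Σ f)
Σ-X· {zero}  f = Σ-[] (λ S → X· (f S)) ▸ X·-cong (≗-sym (Σ-[] f))
Σ-X· {suc n} f =
  Σ-∷-cong (λ S → X· (f S)) (Σ-X· f₀) (Σ-X· f₁)
  ▸ ≗-sym (X·-cong (Σ-∷ f) ▸ X·-⊕ (Σ f₀) (X· (Σ f₁)))
  where
  f₀ = λ S → f (outside ∷ S)
  f₁ = λ S → f (inside ∷ S)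

Σ-[1+X]· : ∀ {n} (f : Subset n → Coeffs) → Σ (λ S → [1+X]· (f S)) ≗ [1+X]· (Σ f)
Σ-[1+X]· f = Σ-⊕ f (λ S → X· (f S)) ▸ ⊕-cong ≗-refl (Σ-X· f)

Σ-when : ∀ {n} {A : Set} (a? : Dec A) (f : Subset n → Coeffs) →
         Σ (λ S → when a? (f S)) ≗ when a? (Σ f)
Σ-when a? f with does a?
... | true  = ≗-refl
... | false = Σ-0# (λ _ → ≗-refl)

-- Used to separate the vertices of a graph from the pendant vertices of its star: the recursion of
-- `Σ` peels off the first `m` coordinates one at a time.
Σ-++ : ∀ m {n} (f : Subset (m + n) → Coeffs) →
       Σ f ≗ Σ {m} (λ S → Σ {n} (λ T → f (S ++ T)))
Σ-++ zero    f = ≗-sym (Σ-[] (λ S → Σ (λ T → f (S ++ T))))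
Σ-++ (suc m) f =
  Σ-∷-cong f (Σ-++ m (λ S → f (outside ∷ S))) (Σ-++ m (λ S → f (inside ∷ S)))
  ▸ ≗-sym (Σ-∷ (λ S → Σ (λ T → f (S ++ T))))

-- Counting by size as a weighted sum

length-filter-map : ∀ {A B : Set} {P : Pred B 0ℓ} (P? : Decidable P) (f : A → B) xs →
                    length (filter P? (map f xs)) ≡ length (filter (P? ∘ f) xs)
length-filter-map P? f []       = refl
length-filter-map P? f (x ∷ xs) with does (P? (f x))
... | true  = cong suc (length-filter-map P? f xs)
... | false = length-filter-map P? f xs

-- `subsets` and `Σ` split on the first coordinate in the same way. In the `inside` half the size
-- grows by one, which is the index shift of `X·`.
length-filter-subsets : ∀ {n} {Q : Pred (Subset n) 0ℓ} (Q? : Decidable Q) k →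
  length (filter (λ S → Q? S ×-dec (∣ S ∣ ≟ k)) (subsets n)) ≡ Σ (λ S → when (Q? S) 1#) k
length-filter-subsets {zero} Q? k =
  trans (singleton k) (sym (Σ-[] (λ S → when (Q? S) 1#) k))
  where
  singleton : ∀ k → length (filter (λ S → Q? S ×-dec (∣ S ∣ ≟ k)) (subsets 0)) ≡ when (Q? []) 1# k
  singleton k with does (Q? []) | k
  ... | true  | zero  = refl
  ... | true  | suc _ = refl
  ... | false | _     = refl
length-filter-subsets {suc n} Q? k =
  trans (cong length (filter-++ R? (map (outside ∷_) (subsets n)) _))
  (trans (length-++ (filter R? (map (outside ∷_) (subsets n))))
  (trans (cong₂ _+_
    (trans (length-filter-map R? (outside ∷_) (subsets n))
           (length-filter-subsets (Q? ∘ (outside ∷_)) k))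
    (trans (length-filter-map R? (inside ∷_) (subsets n))
           (containing-zero k)))
  (sym (Σ-∷ (λ S → when (Q? S) 1#) k))))
  where
  R? = λ S → Q? S ×-dec (∣ S ∣ ≟ k)

  containing-zero : ∀ k →
    length (filter (λ S → Q? (inside ∷ S) ×-dec (suc ∣ S ∣ ≟ k)) (subsets n))
      ≡ X· (Σ (λ S → when (Q? (inside ∷ S)) 1#)) k
  -- A set containing `zero` is never empty, in agreement with the constant coefficient 0 of `X·`.
  containing-zero zero    =
    cong length (filter-none (λ S → Q? (inside ∷ S) ×-dec (suc ∣ S ∣ ≟ zero))
                  (universal (λ _ ()) (subsets n)))
  containing-zero (suc k) =
    trans (cong length (filter-≐ (λ S → Q? (inside ∷ S) ×-dec (suc ∣ S ∣ ≟ suc k))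
                                 (λ S → Q? (inside ∷ S) ×-dec (∣ S ∣ ≟ k))
                                 ( (λ (q , e) → q , suc-injective e)
                                 , (λ (q , e) → q , cong suc e)) (subsets n)))
          (length-filter-subsets (Q? ∘ (inside ∷_)) k)

Σ-independent : ∀ {n} (G : Graph n) → coeff (I G) ≗ Σ (λ S → when (independent? G S) 1#)
Σ-independent G = length-filter-subsets (independent? G)

-- Independent sets

Independent-mono : ∀ {n} {G H : Graph n} {S} → (∀ u v → Adj H u v → Adj G u v) →
                   Independent G S → Independent H S
Independent-mono H⊆G ind u u∈S v v∈S = ind u u∈S v v∈S ∘ H⊆G u v

Independent-cong : ∀ {n} {G H : Graph n} {S} → (∀ u v → Adj G u v ⇔ Adj H u v) →
                   Independent G S ⇔ Independent H S
Independent-cong {G = G} {H} G⇔H =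
  mk⇔ (Independent-mono {G = G} {H} λ u v → from (G⇔H u v))
      (Independent-mono {G = H} {G} λ u v → to (G⇔H u v))

deleteZero : ∀ {n} → Graph (suc n) → Graph n
deleteZero G = record
  { Adj       = λ u v → Adj G (suc u) (suc v)
  ; adj?      = λ u v → adj? G (suc u) (suc v)
  ; symmetric = symmetric G
  ; loopless  = loopless G ∘ suc
  }

independent-outside : ∀ {n} (G : Graph (suc n)) {S} →
                      Independent G (outside ∷ S) ⇔ Independent (deleteZero G) S
independent-outside G {S} = mk⇔
  (λ ind u u∈S v v∈S → ind (suc u) (there u∈S) (suc v) (there v∈S))
  restore
  where
  restore : Independent (deleteZero G) S → Independent G (outside ∷ S)
  restore ind (suc u) (there u∈S) (suc v) (there v∈S) = ind u u∈S v v∈S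

independent-inside : ∀ {n} (G : Graph (suc n)) {S} →
  Independent G (inside ∷ S) ⇔
    (Independent (deleteZero G) S × (∀ v → v ∈ S → ¬ Adj G zero (suc v)))
independent-inside G {S} = mk⇔
  (λ ind → (λ u u∈S v v∈S → ind (suc u) (there u∈S) (suc v) (there v∈S))
         , (λ v v∈S → ind zero here (suc v) (there v∈S)))
  (λ (ind , free) → restore ind free)
  where
  restore : Independent (deleteZero G) S → (∀ v → v ∈ S → ¬ Adj G zero (suc v)) →
            Independent G (inside ∷ S)
  restore ind free zero    _           zero    _           = loopless G zero
  restore ind free zero    _           (suc v) (there v∈S) = free v v∈S
  restore ind free (suc u) (there u∈S) zero    _           = free u u∈S ∘ symmetric G
  restore ind free (suc u) (there u∈S) (suc v) (there v∈S) = ind u u∈S v v∈S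

-- Stars of paths

Disjoint : ∀ {n} → Subset n → Subset n → Set
Disjoint S T = ∀ u → u ∈ S → u ∉ T

disjoint? : ∀ {n} (S T : Subset n) → Dec (Disjoint S T)
disjoint? S T = all? λ u → (u ∈? S) →-dec ¬? (u ∈? T)

disjoint-outsideˡ : ∀ {n} {S T : Subset n} {t} → Disjoint (outside ∷ S) (t ∷ T) ⇔ Disjoint S T
disjoint-outsideˡ = mk⇔
  (λ d u u∈S u∈T → d (suc u) (there u∈S) (there u∈T))
  (λ { d (suc u) (there u∈S) (there u∈T) → d u u∈S u∈T })

disjoint-outsideʳ : ∀ {n} {S T : Subset n} {s} → Disjoint (s ∷ S) (outside ∷ T) ⇔ Disjoint S T
disjoint-outsideʳ = mk⇔
  (λ d u u∈S u∈T → d (suc u) (there u∈S) (there u∈T))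
  (λ { d (suc u) (there u∈S) (there u∈T) → d u u∈S u∈T })

-- This is (1 + x) to the power n - ∣ S ∣, the generating function of the subsets of the complement
-- of `S`.
[1+X]^∁ : ∀ {n} → Subset n → Coeffs
[1+X]^∁ []            = 1#
[1+X]^∁ (outside ∷ S) = [1+X]· ([1+X]^∁ S)
[1+X]^∁ (inside  ∷ S) = [1+X]^∁ S

-- Each vertex outside `S` may or may not lie in `T`, a factor 1 + x; each vertex of `S` is barred
-- from `T`, a factor 1.
Σ-disjoint : ∀ {n} (S : Subset n) → Σ (λ T → when (disjoint? S T) 1#) ≗ [1+X]^∁ S
Σ-disjoint []            = Σ-[] (λ T → when (disjoint? [] T) 1#)
Σ-disjoint (outside ∷ S) =
  Σ-∷-cong (λ T → when (disjoint? (outside ∷ S) T) 1#) (tail outside) (tail inside)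
  where
  tail : ∀ t → Σ (λ T → when (disjoint? (outside ∷ S) (t ∷ T)) 1#) ≗ [1+X]^∁ S
  tail t = Σ-cong (λ T → when-cong (disjoint? (outside ∷ S) (t ∷ T)) (disjoint? S T)
                                   disjoint-outsideˡ ≗-refl)
           ▸ Σ-disjoint S
Σ-disjoint (inside ∷ S) =
  Σ-∷-cong (λ T → when (disjoint? (inside ∷ S) T) 1#)
    (Σ-cong (λ T → when-cong (disjoint? (inside ∷ S) (outside ∷ T)) (disjoint? S T)
                             disjoint-outsideʳ ≗-refl)
     ▸ Σ-disjoint S)
    (Σ-0# (λ T → when-false (disjoint? (inside ∷ S) (inside ∷ T)) {1#}
                            (λ d → d zero here here)))
  ▸ ⊕-identityʳ ([1+X]^∁ S) X·-0#

module _ {m n} (S : Subset m) (T : Subset n) where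

  ∈-++⁺ˡ : ∀ {u} → u ∈ S → u ↑ˡ n ∈ S ++ T
  ∈-++⁺ˡ u∈S = lookup⇒[]= _ _ (trans (lookup-++ˡ S T _) ([]=⇒lookup u∈S))

  ∈-++⁺ʳ : ∀ {u} → u ∈ T → m ↑ʳ u ∈ S ++ T
  ∈-++⁺ʳ u∈T = lookup⇒[]= _ _ (trans (lookup-++ʳ S T _) ([]=⇒lookup u∈T))

  -- The hypothesis is an equation on `splitAt` because adjacency in a star is decided by `splitAt`;
  -- case analysis there supplies exactly this equation.
  ∈-++⁻ˡ : ∀ {u i} → splitAt m i ≡ inj₁ u → i ∈ S ++ T → u ∈ S
  ∈-++⁻ˡ e i∈ with refl ← splitAt⁻¹-↑ˡ e =
    lookup⇒[]= _ _ (trans (sym (lookup-++ˡ S T _)) ([]=⇒lookup i∈))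

  ∈-++⁻ʳ : ∀ {u i} → splitAt m i ≡ inj₂ u → i ∈ S ++ T → u ∈ T
  ∈-++⁻ʳ e i∈ with refl ← splitAt⁻¹-↑ʳ e =
    lookup⇒[]= _ _ (trans (sym (lookup-++ʳ S T _)) ([]=⇒lookup i∈))

-- Edges of the star are of two kinds. Those of `G` constrain `S` alone, and the pendant edge at u
-- forbids u in both `S` and `T`; pendant vertices are pairwise non-adjacent.
independent-star : ∀ {n} (G : Graph n) (S T : Subset n) →
                   Independent (G *ᴳ) (S ++ T) ⇔ (Independent G S × Disjoint S T)
independent-star {n} G S T = mk⇔
  (λ ind →
      (λ u u∈S v v∈S uv → ind _ (∈-++⁺ˡ S T u∈S) _ (∈-++⁺ˡ S T v∈S)
         (subst₂ (StarAdj G) (sym (splitAt-↑ˡ n u n)) (sym (splitAt-↑ˡ n v n)) uv))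
    , (λ u u∈S u∈T → ind _ (∈-++⁺ˡ S T u∈S) _ (∈-++⁺ʳ S T u∈T)
         (subst₂ (StarAdj G) (sym (splitAt-↑ˡ n u n)) (sym (splitAt-↑ʳ n n u)) refl)))
  (λ (ind , d) → restore ind d)
  where
  restore : Independent G S → Disjoint S T → Independent (G *ᴳ) (S ++ T)
  restore ind d i i∈ j j∈ ij with splitAt n i in ei | splitAt n j in ej
  ... | inj₁ u | inj₁ v = ind u (∈-++⁻ˡ S T ei i∈) v (∈-++⁻ˡ S T ej j∈) ij
  ... | inj₁ u | inj₂ v with refl ← ij = d u (∈-++⁻ˡ S T ei i∈) (∈-++⁻ʳ S T ej j∈)
  ... | inj₂ u | inj₁ v with refl ← ij = d u (∈-++⁻ˡ S T ej j∈) (∈-++⁻ʳ S T ei i∈)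

-- In closed form (1 + x)^n I(G, x / (1 + x)), written without division.
starSum : ∀ {n} → Graph n → Coeffs
starSum G = Σ (λ S → when (independent? G S) ([1+X]^∁ S))

I-star : ∀ {n} (G : Graph n) → coeff (I (G *ᴳ)) ≗ starSum G
I-star {n} G = Σ-independent (G *ᴳ) ▸ Σ-++ n _ ▸ Σ-cong λ S →
  -- For a fixed `S` the condition on `S` leaves the inner sum, and what remains over `T` is the sum
  -- evaluated by `Σ-disjoint`.
  Σ-cong (λ T →
    when-cong (independent? (G *ᴳ) (S ++ T)) (independent? G S ×-dec disjoint? S T)
              (independent-star G S T) ≗-refl
    ▸ when-×-dec (independent? G S) (disjoint? S T))
  ▸ Σ-when (independent? G S) (λ T → when (disjoint? S T) 1#)
  ▸ when-cong (independent? G S) (independent? G S) (mk⇔ id id) (Σ-disjoint S)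

independent-path-deleteZero : ∀ {n} {S : Subset n} →
                              Independent (deleteZero (P (suc n))) S ⇔ Independent (P n) S
independent-path-deleteZero {n} = Independent-cong {G = deleteZero (P (suc n))} {P n} λ _ _ →
  mk⇔ (Sum.map suc-injective suc-injective) (Sum.map (cong suc) (cong suc))

independent-path-outside : ∀ {n} {S : Subset n} →
                           Independent (P (suc n)) (outside ∷ S) ⇔ Independent (P n) S
independent-path-outside {n} =
  ⇔-trans (independent-outside (P (suc n))) independent-path-deleteZero

independent-path-inside : ∀ {n} {S : Subset n} →
                          Independent (P (2 + n)) (inside ∷ outside ∷ S) ⇔ Independent (P n) S
independent-path-inside {n} = ⇔-trans (independent-inside (P (2 + n))) (mk⇔
  (to tail ∘ proj₁)
  -- The only neighbour of the end vertex is `suc zero`, which is outside; every remaining vertex is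
  -- at distance at least two.
  (λ ind → from tail ind , λ { (suc v) _ (inj₁ ()) ; (suc v) _ (inj₂ ()) }))
  where
  tail = ⇔-trans independent-path-deleteZero independent-path-outside

-- With the end vertex outside, its pendant vertex is free and gives a factor 1 + x. With it inside,
-- the next vertex must be outside, and the factor 1 + x comes from the pendant vertex of that one.
starSum-path : ∀ n → starSum (P (2 + n)) ≗
               [1+X]· (starSum (P (1 + n))) ⊕ X· ([1+X]· (starSum (P n)))
starSum-path n = Σ-∷-cong (term (2 + n))
  (Σ-cong (λ S → when-cong (independent? (P (2 + n)) (outside ∷ S))
                           (independent? (P (1 + n)) S) independent-path-outside ≗-refl
                 ▸ when-[1+X]· (independent? (P (1 + n)) S) {[1+X]^∁ S})
   ▸ Σ-[1+X]· (term (1 + n)))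
  (Σ-∷-cong (λ S → term (2 + n) (inside ∷ S))
    (Σ-cong (λ S → when-cong (independent? (P (2 + n)) (inside ∷ outside ∷ S))
                             (independent? (P n) S) independent-path-inside ≗-refl
                   ▸ when-[1+X]· (independent? (P n) S) {[1+X]^∁ S})
     ▸ Σ-[1+X]· (term n))
    (Σ-0# λ S → when-false (independent? (P (2 + n)) (inside ∷ inside ∷ S)) {[1+X]^∁ S}
                           (λ ind → ind zero here (suc zero) (there here) (inj₁ refl)))
   ▸ ⊕-identityʳ ([1+X]· (starSum (P n))) X·-0#)
  where
  term : ∀ n → Subset n → Coeffs
  term n S = when (independent? (P n) S) ([1+X]^∁ S)

-- The trees G_{2n}

independentSum : ∀ {n} → Graph n → Coeffs
independentSum G = Σ (λ S → when (independent? G S) 1#)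

-- A vertex newly joined to `r` can be added to exactly the independent sets counted here, so the
-- recursion for `independentSum` does not close without this second sequence.
avoidingSum : ∀ {n} → Graph n → Fin n → Coeffs
avoidingSum G r = Σ (λ S → when (independent? G S ×-dec ¬? (r ∈? S)) 1#)

module _ {n} (G : Graph n) (r : Fin n) where

  private
    H = appendK₂ G r

  independent-append-outside : ∀ {S} → Independent H (outside ∷ outside ∷ S) ⇔ Independent G S
  independent-append-outside =
    ⇔-trans (independent-outside H) (independent-outside (deleteZero H))

  independent-append-w : ∀ {S} → Independent H (outside ∷ inside ∷ S) ⇔ Independent G S
  independent-append-w =
    ⇔-trans (independent-outside H)
      -- The new leaf has no neighbour in `G`, so the condition on `S` holds vacuously.
      (⇔-trans (independent-inside (deleteZero H)) (mk⇔ proj₁ (_, λ _ _ ())))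

  independent-append-v : ∀ {S} →
    Independent H (inside ∷ outside ∷ S) ⇔ (Independent G S × r ∉ S)
  independent-append-v = ⇔-trans (independent-inside H) (mk⇔
    (λ (ind , free) → to (independent-outside (deleteZero H)) ind
                    , λ r∈S → free (suc r) (there r∈S) refl)
    (λ (ind , r∉S) → from (independent-outside (deleteZero H)) ind
                    , λ { (suc v) (there v∈S) refl → r∉S v∈S }))

  -- Once the joining vertex is left out, the new leaf is isolated and contributes 1 + x.
  Σ-append-outside : Σ (λ S → when (independent? H (outside ∷ S)) 1#) ≗ [1+X]· (independentSum G)
  Σ-append-outside = Σ-∷-cong (λ S → when (independent? H (outside ∷ S)) 1#)
    (Σ-cong λ S → when-cong (independent? H (outside ∷ outside ∷ S)) (independent? G S)
                            independent-append-outside ≗-refl)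
    (Σ-cong λ S → when-cong (independent? H (outside ∷ inside ∷ S)) (independent? G S)
                            independent-append-w ≗-refl)

  -- If the joining vertex is chosen, the leaf is excluded and so is `r`, which leaves
  -- `avoidingSum G r`.
  independentSum-append :
    independentSum H ≗ [1+X]· (independentSum G) ⊕ X· (avoidingSum G r)
  independentSum-append = Σ-∷-cong (λ S → when (independent? H S) 1#)
    Σ-append-outside
    (Σ-∷-cong (λ S → when (independent? H (inside ∷ S)) 1#)
      (Σ-cong λ S → when-cong (independent? H (inside ∷ outside ∷ S))
                              (independent? G S ×-dec ¬? (r ∈? S))
                              independent-append-v ≗-refl)
      (Σ-0# λ S → when-false (independent? H (inside ∷ inside ∷ S)) {1#}
                             (λ ind → ind zero here (suc zero) (there here) _))
     ▸ ⊕-identityʳ (avoidingSum G r) X·-0#)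

  -- The root has moved to `zero`, so avoiding it is the case already summed in `Σ-append-outside`.
  avoidingSum-append : avoidingSum H zero ≗ [1+X]· (independentSum G)
  avoidingSum-append =
    Σ-∷-cong (λ S → when (independent? H S ×-dec ¬? (zero ∈? S)) 1#)
      (Σ-cong (λ S → when-cong (independent? H (outside ∷ S) ×-dec ¬? (zero ∈? outside ∷ S))
                               (independent? H (outside ∷ S))
                               (mk⇔ proj₁ (_, λ ())) ≗-refl)
       ▸ Σ-append-outside)
      (Σ-0# λ S → when-false (independent? H (inside ∷ S) ×-dec ¬? (zero ∈? inside ∷ S)) {1#}
                             (λ (_ , ∉) → ∉ here))
    ▸ ⊕-identityʳ ([1+X]· (independentSum G)) X·-0#

-- The base case: the tree on ten vertices

-- Checking nine edges instead of a hundred pairs of vertices keeps the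
-- evaluation over all subsets of Fin 10 short.

NoEdgeInside : ∀ {n} → List (Fin n × Fin n) → Subset n → Set
NoEdgeInside E S = All (λ (u , v) → ¬ (u ∈ S × v ∈ S)) E

noEdgeInside? : ∀ {n} (E : List (Fin n × Fin n)) S → Dec (NoEdgeInside E S)
noEdgeInside? E S = All.all? (λ (u , v) → ¬? (u ∈? S ×-dec v ∈? S)) E

independent-edges : ∀ {n} (G : Graph n) (E : List (Fin n × Fin n)) {S} →
                    (∀ u v → Adj G u v ⇔ ((u , v) List.∈ E ⊎ (v , u) List.∈ E)) →
                    Independent G S ⇔ NoEdgeInside E S
independent-edges G E adj = mk⇔
  (λ ind → All.tabulate λ uv∈E (u∈S , v∈S) → ind _ u∈S _ v∈S (from (adj _ _) (inj₁ uv∈E)))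
  (λ none u u∈S v v∈S → [ (λ uv∈E → All.lookup none uv∈E (u∈S , v∈S))
                        , (λ vu∈E → All.lookup none vu∈E (v∈S , u∈S)) ]′ ∘ to (adj u v))

independent-G₁₀ : ∀ {S} → Independent G₁₀ S ⇔ NoEdgeInside edges₁₀ S
independent-G₁₀ = independent-edges G₁₀ edges₁₀ λ _ _ → mk⇔ id id

opaque
  unfolding Σ

  edges₁₀-sum : Σ (λ S → when (noEdgeInside? edges₁₀ S) 1#) ≗ starSum (P 5)
  edges₁₀-sum 0 = refl
  edges₁₀-sum 1 = refl
  edges₁₀-sum 2 = refl
  edges₁₀-sum 3 = refl
  edges₁₀-sum 4 = refl
  edges₁₀-sum 5 = refl
  edges₁₀-sum 6 = refl
  edges₁₀-sum 7 = refl
  edges₁₀-sum 8 = refl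
  edges₁₀-sum 9 = refl
  edges₁₀-sum 10 = refl
  -- Every subset involves at most ten shifts. Eleven successors keep the open index a successor
  -- after all of them, so every term on both sides reduces to 0.
  edges₁₀-sum (suc (suc (suc (suc (suc (suc (suc (suc (suc (suc (suc _))))))))))) = refl

  edges₁₀-avoiding-sum : Σ (λ S → when (noEdgeInside? edges₁₀ S ×-dec ¬? (v₅ ∈? S)) 1#)
                         ≗ [1+X]· (starSum (P 4))
  edges₁₀-avoiding-sum 0 = refl
  edges₁₀-avoiding-sum 1 = refl
  edges₁₀-avoiding-sum 2 = refl
  edges₁₀-avoiding-sum 3 = refl
  edges₁₀-avoiding-sum 4 = refl
  edges₁₀-avoiding-sum 5 = refl
  edges₁₀-avoiding-sum 6 = refl
  edges₁₀-avoiding-sum 7 = refl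
  edges₁₀-avoiding-sum 8 = refl
  edges₁₀-avoiding-sum 9 = refl
  edges₁₀-avoiding-sum 10 = refl
  edges₁₀-avoiding-sum (suc (suc (suc (suc (suc (suc (suc (suc (suc (suc (suc _))))))))))) = refl

G₁₀-sum : independentSum G₁₀ ≗ starSum (P 5)
G₁₀-sum = Σ-cong (λ S → when-cong (independent? G₁₀ S) (noEdgeInside? edges₁₀ S)
                                  independent-G₁₀ ≗-refl)
          ▸ edges₁₀-sum

G₁₀-avoiding-sum : avoidingSum G₁₀ v₅ ≗ [1+X]· (starSum (P 4))
G₁₀-avoiding-sum =
  Σ-cong (λ S → when-cong (independent? G₁₀ S ×-dec ¬? (v₅ ∈? S))
                          (noEdgeInside? edges₁₀ S ×-dec ¬? (v₅ ∈? S))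
                          (independent-G₁₀ ×-⇔ mk⇔ id id) ≗-refl)
  ▸ edges₁₀-avoiding-sum

-- Induction along the trees

module _ {n} (G : Graph n) (r : Fin n) {f g : Coeffs}
         (all : independentSum G ≗ f) (avoiding : avoidingSum G r ≗ g) where

  independentSum-append-≗ : independentSum (appendK₂ G r) ≗ [1+X]· f ⊕ X· g
  independentSum-append-≗ =
    independentSum-append G r ▸ ⊕-cong ([1+X]·-cong all) (X·-cong avoiding)

  avoidingSum-append-≗ : avoidingSum (appendK₂ G r) zero ≗ [1+X]· f
  avoidingSum-append-≗ = avoidingSum-append G r ▸ [1+X]·-cong all

tree-path : ∀ m → let G , v = tree m in
  independentSum G ≗ starSum (P (5 + m)) × avoidingSum G v ≗ [1+X]· (starSum (P (4 + m)))
tree-path zero    = G₁₀-sum , G₁₀-avoiding-sum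
tree-path (suc m) = let G , v = tree m ; all , avoiding = tree-path m in
    -- With the two induction hypotheses inserted, the recursion for the tree is literally the
    -- right-hand side of `starSum-path (4 + m)`.
    (independentSum-append-≗ G v all avoiding ▸ ≗-sym (starSum-path (4 + m)))
  , avoidingSum-append-≗ G v all avoiding

I-star-≈ : ∀ {m n} (G : Graph m) (H : Graph n) → independentSum H ≗ starSum G → I (G *ᴳ) ≈ I H
I-star-≈ G H e = I-star G ▸ ≗-sym (Σ-independent H ▸ e)

G₂-path : ∀ n (5≤n : 5 ≤ n) → independentSum (G₂ n 5≤n) ≗ starSum (P n)
-- The same pattern as in the definition of `G₂`, so that `G₂ n 5≤n` reduces to `proj₁ (tree m)`.
G₂-path _ (s≤s (s≤s (s≤s (s≤s (s≤s (z≤n {m})))))) = proj₁ (tree-path m)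

theorem4p4 : ∀ (n : ℕ) (6≤n : 6 ≤ n) → I (P n *ᴳ) ≈ I (G₂ n (<⇒≤ 6≤n))
theorem4p4 n 6≤n = I-star-≈ (P n) (G₂ n (<⇒≤ 6≤n)) (G₂-path n (<⇒≤ 6≤n))
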